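{- The axiom system $\mathcal{R}$ consisting of (R1), (R2), (R3), (R4), (R5), (R6), (R8$'$), (R9), (R10) is equivalent to Tarski's system (R1)--(R10). That is, an algebra $\mathfrak{A}=(A,+,-,;,{}^{\smile},1')$ satisfies all axioms of $\mathcal{R}$ if and only if it satisfies all of (R1)--(R10).
   Context: All algebras have the form $\mathfrak{A}=(A,+,-,;,{}^{\smile},1')$, where $A$ is a non-empty set, $+$ and $;$ are binary operations on $A$, $-$ and ${}^{\smile}$ are unary operations on $A$, and $1'$ is a distinguished element of $A$. Unary operations bind more tightly than binary ones, and $;$ binds more tightly than $+$. An algebra satisfies an axiom if the axiom holds for all elements $r,s,t\in A$. The axioms are: (R1) $r+s=s+r$; (R2) $r+(s+t)=(r+s)+t$; (R3) $-(-r+s)+-(-r+-s)=r$; (R4) $r;(s;t)=(r;s);t$; (R5) $r;1'=r$; (R6) $(r^{\smile})^{\smile}=r$; (R7) $(r;s)^{\smile}=s^{\smile};r^{\smile}$; (R8) $(r+s);t=r;t+s;t$; (R9) $(r+s)^{\smile}=r^{\smile}+s^{\smile}$; (R10) $r^{\smile};-(r;s)+-s=-s$, i.e. $\bigl((r^{\smile});(-(r;s))\bigr)+(-s)=-s$; and the left-hand distributive law (R8$'$) $r;(s+t)=r;s+r;t$. So $\mathcal{R}$ is obtained from (R1)--(R10) by dropping (R7) and replacing (R8) by (R8$'$). -}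

module Defs where

open import Level using (suc; _⊔_)
open import Relation.Binary.Core using (Rel)
open import Relation.Binary.Structures using (IsEquivalence)
open import Algebra.Core using (Op₁; Op₂)
open import Algebra.Definitions using (Congruent₁; Congruent₂)

-- Equality is a setoid equality respected by all operations, as in the
-- library's algebraic hierarchy; the case _≈_ = _≡_ is included.
-- Non-emptiness of the carrier is witnessed by 1'.
-- The character ; is reserved in Agda, so relative multiplication is ⨾.
record Structure a ℓ : Set (suc (a ⊔ ℓ)) where
  infix  4 _≈_
  infixl 6 _+_
  infixl 7 _⨾_
  infix  8 -_
  infix  9 _˘
  field
    Carrier       : Set a
    _≈_           : Rel Carrier ℓ
    _+_           : Op₂ Carrier
    -_            : Op₁ Carrier
    _⨾_           : Op₂ Carrier
    _˘            : Op₁ Carrier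
    1'            : Carrier
    isEquivalence : IsEquivalence _≈_
    +-cong        : Congruent₂ _≈_ _+_
    -‿cong        : Congruent₁ _≈_ -_
    ⨾-cong        : Congruent₂ _≈_ _⨾_
    ˘-cong        : Congruent₁ _≈_ _˘

module Axioms {a ℓ} (𝔄 : Structure a ℓ) where
  open Structure 𝔄

  R1 R2 R3 R4 R5 R6 R7 R8 R8′ R9 R10 : Set (a ⊔ ℓ)
  R1  = ∀ r s   → r + s ≈ s + r
  R2  = ∀ r s t → r + (s + t) ≈ (r + s) + t
  R3  = ∀ r s   → - (- r + s) + - (- r + - s) ≈ r
  R4  = ∀ r s t → r ⨾ (s ⨾ t) ≈ (r ⨾ s) ⨾ t
  R5  = ∀ r     → r ⨾ 1' ≈ r
  R6  = ∀ r     → (r ˘) ˘ ≈ r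
  R7  = ∀ r s   → (r ⨾ s) ˘ ≈ s ˘ ⨾ r ˘
  R8  = ∀ r s t → (r + s) ⨾ t ≈ r ⨾ t + s ⨾ t
  R8′ = ∀ r s t → r ⨾ (s + t) ≈ r ⨾ s + r ⨾ t
  R9  = ∀ r s   → (r + s) ˘ ≈ r ˘ + s ˘
  R10 = ∀ r s   → ((r ˘) ⨾ (- (r ⨾ s))) + (- s) ≈ - s

record IsTarski {a ℓ} (𝔄 : Structure a ℓ) : Set (a ⊔ ℓ) where
  open Axioms 𝔄
  field
    r1  : R1
    r2  : R2
    r3  : R3
    r4  : R4
    r5  : R5
    r6  : R6
    r7  : R7
    r8  : R8
    r9  : R9
    r10 : R10

record Isℛ {a ℓ} (𝔄 : Structure a ℓ) : Set (a ⊔ ℓ) where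
  open Axioms 𝔄
  field
    r1  : R1
    r2  : R2
    r3  : R3
    r4  : R4
    r5  : R5
    r6  : R6
    r8′ : R8′
    r9  : R9
    r10 : R10

-- By (R8′), (R9), (R10) and (R6), left multiplication by r ˘ is the Boolean
-- conjugate of left multiplication by r.  Conjugates are unique, and by (R4)
-- both (r ⨾ s) ˘ and s ˘ ⨾ r ˘ induce the conjugate of left multiplication by
-- r ⨾ s; evaluating at 1' yields (R7).  Given (R6), (R7) and (R9), the two
-- distributive laws are exchanged by converse.

{-# OPTIONS --safe #-}
module Submission where

open import Defs
open import Algebra.Bundles using (CommutativeSemigroup)
open import Function.Bundles using (_⇔_; mk⇔)
open import Relation.Binary.Bundles using (Setoid)
open import Relation.Binary.Structures using (IsEquivalence)
import Algebra.Properties.CommutativeSemigroup as CommutativeSemigroupProperties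
import Relation.Binary.Reasoning.Setoid as SetoidReasoning

module StructureReasoning {a ℓ} (𝔄 : Structure a ℓ) where
  open Structure 𝔄
  open IsEquivalence isEquivalence public

  setoid : Setoid a ℓ
  setoid = record { isEquivalence = isEquivalence }

  open SetoidReasoning setoid public

  +-congˡ : ∀ {x y z} → y ≈ z → x + y ≈ x + z
  +-congˡ = +-cong refl

  +-congʳ : ∀ {x y z} → y ≈ z → y + x ≈ z + x
  +-congʳ y≈z = +-cong y≈z refl

module Huntington {a ℓ} (𝔄 : Structure a ℓ)
                  (r1 : Axioms.R1 𝔄) (r2 : Axioms.R2 𝔄) (r3 : Axioms.R3 𝔄) where
  open Structure 𝔄
  open StructureReasoning 𝔄

  +-commutativeSemigroup : CommutativeSemigroup a ℓ
  +-commutativeSemigroup = record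
    { isCommutativeSemigroup = record
      { isSemigroup = record
        { isMagma = record { isEquivalence = isEquivalence ; ∙-cong = +-cong }
        ; assoc = λ x y z → sym (r2 x y z)
        }
      ; comm = r1
      }
    }

  open CommutativeSemigroupProperties +-commutativeSemigroup using (interchange)

  -- `R3` splits `x` along `- y` and also `- x` along `- y`. The four resulting summands form a
  -- family symmetric in `x` and `y`, so regrouping them gives the other side.
  x+-x≈y+-y : ∀ x y → x + - x ≈ y + - y
  x+-x≈y+-y x y = begin
    x + - x
      ≈⟨ +-cong (r3 x (- y)) (r3 (- x) (- y)) ⟨
    (- (- x + - y) + - (- x + - - y)) + (- (- - x + - y) + - (- - x + - - y))
      ≈⟨ interchange _ _ _ _ ⟩
    (- (- x + - y) + - (- - x + - y)) + (- (- x + - - y) + - (- - x + - - y))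
      ≈⟨ +-cong (+-cong (-‿cong (r1 _ _)) (-‿cong (r1 _ _)))
                (+-cong (-‿cong (r1 _ _)) (-‿cong (r1 _ _))) ⟩
    (- (- y + - x) + - (- y + - - x)) + (- (- - y + - x) + - (- - y + - - x))
      ≈⟨ +-cong (r3 y (- x)) (r3 (- y) (- x)) ⟩
    y + - y ∎

  -- `R3` for `- - x` along `- x` and `R3` for `x` along `- - x` have the same summands: one pair
  -- agrees by commutativity, the other by `x+-x≈y+-y`.
  -‿involutive : ∀ x → - - x ≈ x
  -‿involutive x = begin
    - - x
      ≈⟨ r3 (- - x) (- x) ⟨
    - (- - - x + - x) + - (- - - x + - - x)
      ≈⟨ +-cong (-‿cong (r1 _ _))
                (-‿cong (trans (r1 _ _) (x+-x≈y+-y (- - x) (- x)))) ⟩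
    - (- x + - - - x) + - (- x + - - x)
      ≈⟨ r1 _ _ ⟩
    - (- x + - - x) + - (- x + - - - x)
      ≈⟨ r3 x (- - x) ⟩
    x ∎

  module _ (x : Carrier) where
    private
      ⊤ ⊥ : Carrier
      ⊤ = x + - x
      ⊥ = - ⊤

    ⊥+-[-x+-x]≈x : ⊥ + - (- x + - x) ≈ x
    ⊥+-[-x+-x]≈x = begin
      ⊥ + - (- x + - x)           ≈⟨ +-congʳ (-‿cong (r1 _ _)) ⟩
      - (- x + x) + - (- x + - x) ≈⟨ r3 x x ⟩
      x                           ∎

    ⊤+⊥≈⊤ : ⊤ + ⊥ ≈ ⊤
    ⊤+⊥≈⊤ = x+-x≈y+-y ⊤ x

    -- This is `R3` for `⊥` along `⊤`, with `- ⊥` replaced by `⊤`.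
    -[⊤+⊤]+⊥≈⊥ : - (⊤ + ⊤) + ⊥ ≈ ⊥
    -[⊤+⊤]+⊥≈⊥ = begin
      - (⊤ + ⊤) + ⊥
        ≈⟨ +-cong (-‿cong (+-congʳ (-‿involutive ⊤)))
                  (-‿cong (trans (+-cong (-‿involutive ⊤) refl) ⊤+⊥≈⊤)) ⟨
      - (- ⊥ + ⊤) + - (- ⊥ + - ⊤)
        ≈⟨ r3 ⊥ ⊤ ⟩
      ⊥ ∎

    ⊤+⊤≈⊤ : ⊤ + ⊤ ≈ ⊤
    ⊤+⊤≈⊤ = begin
      ⊤ + ⊤                     ≈⟨ +-congˡ ⊤+⊥≈⊤ ⟨
      -- Expanding `⊥` puts `- (⊤ + ⊤)` beside `⊤ + ⊤`, and this pair collapses to `⊤`.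
      ⊤ + (⊤ + ⊥)               ≈⟨ +-congˡ (+-congˡ -[⊤+⊤]+⊥≈⊥) ⟨
      ⊤ + (⊤ + (- (⊤ + ⊤) + ⊥)) ≈⟨ r2 _ _ _ ⟩
      ⊤ + ⊤ + (- (⊤ + ⊤) + ⊥)   ≈⟨ r2 _ _ _ ⟩
      ⊤ + ⊤ + - (⊤ + ⊤) + ⊥     ≈⟨ +-congʳ (x+-x≈y+-y (⊤ + ⊤) x) ⟩
      ⊤ + ⊥                     ≈⟨ ⊤+⊥≈⊤ ⟩
      ⊤                         ∎

    ⊥+⊥≈⊥ : ⊥ + ⊥ ≈ ⊥
    ⊥+⊥≈⊥ = trans (+-congʳ (-‿cong (sym ⊤+⊤≈⊤))) -[⊤+⊤]+⊥≈⊥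

    ⊥+x≈x : ⊥ + x ≈ x
    ⊥+x≈x = begin
      ⊥ + x                     ≈⟨ +-congˡ ⊥+-[-x+-x]≈x ⟨
      ⊥ + (⊥ + - (- x + - x))   ≈⟨ r2 _ _ _ ⟩
      ⊥ + ⊥ + - (- x + - x)     ≈⟨ +-congʳ ⊥+⊥≈⊥ ⟩
      ⊥ + - (- x + - x)         ≈⟨ ⊥+-[-x+-x]≈x ⟩
      x                         ∎

  +-idem : ∀ x → x + x ≈ x
  +-idem x = begin
    x + x                           ≈⟨ -‿involutive (x + x) ⟨
    - - (x + x)                     ≈⟨ -‿cong -[x+x]≈-x ⟩
    - - x                           ≈⟨ -‿involutive x ⟩
    x                               ∎
    where
    -- `R3` for `- x` along itself reads `⊥ + - (x + x)` up to double complement, and `⊥` is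
    -- neutral.
    -[x+x]≈-x : - (x + x) ≈ - x
    -[x+x]≈-x = begin
      - (x + x)                           ≈⟨ ⊥+x≈x (- (x + x)) ⟨
      - (- (x + x) + - - (x + x)) + - (x + x)
        ≈⟨ +-cong (-‿cong (x+-x≈y+-y _ (- x)))
                  (-‿cong (+-cong (sym (-‿involutive x)) (sym (-‿involutive x)))) ⟩
      - (- x + - - x) + - (- - x + - - x) ≈⟨ ⊥+-[-x+-x]≈x (- x) ⟩
      - x                                 ∎

  infix 4 _≤_
  _≤_ : Carrier → Carrier → Set ℓ
  x ≤ y = x + y ≈ y

  ≤-trans : ∀ {x y z} → x ≤ y → y ≤ z → x ≤ z
  ≤-trans {x} {y} {z} x≤y y≤z = begin
    x + z       ≈⟨ +-congˡ y≤z ⟨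
    x + (y + z) ≈⟨ r2 x y z ⟩
    x + y + z   ≈⟨ +-congʳ x≤y ⟩
    y + z       ≈⟨ y≤z ⟩
    z           ∎

  ≤-antisym : ∀ {x y} → x ≤ y → y ≤ x → x ≈ y
  ≤-antisym x≤y y≤x = trans (sym y≤x) (trans (r1 _ _) x≤y)

  ≤-respˡ : ∀ {x y z} → x ≈ y → x ≤ z → y ≤ z
  ≤-respˡ x≈y x≤z = trans (+-congʳ (sym x≈y)) x≤z

  ≤--swap : ∀ {x y} → x ≤ - y → y ≤ - x
  ≤--swap {x} {y} x≤-y = begin
    y + - x             ≈⟨ +-congˡ -x≈y+-[x+y] ⟩
    y + (y + - (x + y)) ≈⟨ r2 _ _ _ ⟩
    y + y + - (x + y)   ≈⟨ +-congʳ (+-idem y) ⟩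
    y + - (x + y)       ≈⟨ -x≈y+-[x+y] ⟨
    - x                 ∎
    where
    -- `R3` splits `- x` along `y`; the hypothesis turns one of the two parts into `- - y`.
    -x≈y+-[x+y] : - x ≈ y + - (x + y)
    -x≈y+-[x+y] = begin
      - x                             ≈⟨ r3 (- x) y ⟨
      - (- - x + y) + - (- - x + - y)
        ≈⟨ +-cong (-‿cong (+-congʳ (-‿involutive x)))
                  (-‿cong (trans (+-congʳ (-‿involutive x)) x≤-y)) ⟩
      - (x + y) + - - y               ≈⟨ r1 _ _ ⟩
      - - y + - (x + y)               ≈⟨ +-congʳ (-‿involutive y) ⟩
      y + - (x + y)                   ∎

  -- Every element is a complement, so bounds of the form `- z` suffice. This form turns
  -- inequalities into disjointness statements, which the conjugation lemmas can move.
  ≤-fromUpperBounds : ∀ {x y} → (∀ z → y ≤ - z → x ≤ - z) → x ≤ y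
  ≤-fromUpperBounds {x} {y} h = begin
    x + y     ≈⟨ +-congˡ (-‿involutive y) ⟨
    x + - - y ≈⟨ h (- y) (trans (+-congˡ (-‿involutive y)) (trans (+-idem y) (sym (-‿involutive y)))) ⟩
    - - y     ≈⟨ -‿involutive y ⟩
    y         ∎

module _ {a ℓ} (𝔄 : Structure a ℓ) where
  open Structure 𝔄
  open Axioms 𝔄
  open StructureReasoning 𝔄

  module FromℛAxioms (ℛ : Isℛ 𝔄) where
    open Isℛ ℛ
    open Huntington 𝔄 r1 r2 r3

    -- The left-hand distributive law enters here: it makes left multiplication monotone.
    ⨾-monoʳ : ∀ {x y} r → x ≤ y → r ⨾ x ≤ r ⨾ y
    ⨾-monoʳ r x≤y = trans (sym (r8′ r _ _)) (⨾-cong refl x≤y)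

    -- x ≤ - y says that x and y are disjoint.
    ⨾-conjugate : ∀ {r s x} → r ⨾ s ≤ - x → r ˘ ⨾ x ≤ - s
    ⨾-conjugate {r} {s} rs≤-x = ≤-trans (⨾-monoʳ (r ˘) (≤--swap rs≤-x)) (r10 r s)

    ˘⨾-conjugate : ∀ {r s x} → r ˘ ⨾ s ≤ - x → r ⨾ x ≤ - s
    ˘⨾-conjugate h = ≤-respˡ (⨾-cong (r6 _) refl) (⨾-conjugate h)

    -- Either side is disjoint from `z` exactly when `r ⨾ s ⨾ z` is disjoint from `x`.
    [r⨾s]˘⨾x≈s˘⨾[r˘⨾x] : ∀ r s x → (r ⨾ s) ˘ ⨾ x ≈ s ˘ ⨾ (r ˘ ⨾ x)
    [r⨾s]˘⨾x≈s˘⨾[r˘⨾x] r s x = ≤-antisym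
      -- The factors `s ˘` and `r ˘` move onto `z` one at a time, `R4` regroups them, and a single
      -- conjugation by `r ⨾ s` moves them back; the other inequality reverses this route.
      (≤-fromUpperBounds λ z h →
        ⨾-conjugate (≤-respˡ (r4 r s z)
          (˘⨾-conjugate (≤--swap (˘⨾-conjugate h)))))
      (≤-fromUpperBounds λ z h →
        ⨾-conjugate (≤--swap
          (⨾-conjugate (≤-respˡ (sym (r4 r s z)) (˘⨾-conjugate h)))))

    r7 : R7
    r7 r s = begin
      (r ⨾ s) ˘          ≈⟨ r5 _ ⟨
      (r ⨾ s) ˘ ⨾ 1'     ≈⟨ [r⨾s]˘⨾x≈s˘⨾[r˘⨾x] r s 1' ⟩
      s ˘ ⨾ (r ˘ ⨾ 1')   ≈⟨ ⨾-cong refl (r5 _) ⟩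
      s ˘ ⨾ r ˘          ∎

  module _ (r6 : R6) (r7 : R7) (r9 : R9) where

    -- Rewriting a product in this way swaps the sides of its factors, so a sum on one side can be
    -- distributed by the law for the other.
    [s˘⨾r˘]˘≈r⨾s : ∀ r s → (s ˘ ⨾ r ˘) ˘ ≈ r ⨾ s
    [s˘⨾r˘]˘≈r⨾s r s = trans (˘-cong (sym (r7 r s))) (r6 (r ⨾ s))

    r8′⇒r8 : R8′ → R8
    r8′⇒r8 r8′ r s t = begin
      (r + s) ⨾ t                     ≈⟨ [s˘⨾r˘]˘≈r⨾s (r + s) t ⟨
      (t ˘ ⨾ (r + s) ˘) ˘             ≈⟨ ˘-cong (⨾-cong refl (r9 r s)) ⟩
      (t ˘ ⨾ (r ˘ + s ˘)) ˘           ≈⟨ ˘-cong (r8′ _ _ _) ⟩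
      (t ˘ ⨾ r ˘ + t ˘ ⨾ s ˘) ˘       ≈⟨ r9 _ _ ⟩
      (t ˘ ⨾ r ˘) ˘ + (t ˘ ⨾ s ˘) ˘   ≈⟨ +-cong ([s˘⨾r˘]˘≈r⨾s r t) ([s˘⨾r˘]˘≈r⨾s s t) ⟩
      r ⨾ t + s ⨾ t                   ∎

    r8⇒r8′ : R8 → R8′
    r8⇒r8′ r8 r s t = begin
      r ⨾ (s + t)                     ≈⟨ [s˘⨾r˘]˘≈r⨾s r (s + t) ⟨
      ((s + t) ˘ ⨾ r ˘) ˘             ≈⟨ ˘-cong (⨾-cong (r9 s t) refl) ⟩
      ((s ˘ + t ˘) ⨾ r ˘) ˘           ≈⟨ ˘-cong (r8 _ _ _) ⟩
      (s ˘ ⨾ r ˘ + t ˘ ⨾ r ˘) ˘       ≈⟨ r9 _ _ ⟩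
      (s ˘ ⨾ r ˘) ˘ + (t ˘ ⨾ r ˘) ˘   ≈⟨ +-cong ([s˘⨾r˘]˘≈r⨾s r s) ([s˘⨾r˘]˘≈r⨾s r t) ⟩
      r ⨾ s + r ⨾ t                   ∎

  ℛ⇒Tarski : Isℛ 𝔄 → IsTarski 𝔄
  ℛ⇒Tarski ℛ = record
    { Isℛ ℛ ; r7 = r7 ; r8 = r8′⇒r8 r6 r7 r9 r8′ }
    where
    open Isℛ ℛ
    open FromℛAxioms ℛ using (r7)

  Tarski⇒ℛ : IsTarski 𝔄 → Isℛ 𝔄
  Tarski⇒ℛ T = record { IsTarski T ; r8′ = r8⇒r8′ r6 r7 r9 r8 }
    where open IsTarski T

theorem2 : ∀ {a ℓ} (𝔄 : Structure a ℓ) → Isℛ 𝔄 ⇔ IsTarski 𝔄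
theorem2 𝔄 = mk⇔ (ℛ⇒Tarski 𝔄) (Tarski⇒ℛ 𝔄)
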